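{- Let $\operatorname{sm}$ and $\operatorname{cm}$ be the functions analytic near $0$ defined by $\operatorname{sm}'=\operatorname{cm}^2$, $\operatorname{cm}'=-\operatorname{sm}^2$, $\operatorname{sm}(0)=0$, $\operatorname{cm}(0)=1$. For a power series $f(u)=\sum_{\nu\ge0}c_\nu u^\nu/\nu!$ write $\int_0^\infty f(u)e^{ -u/x}\,du:=\sum_{\nu\ge0}c_\nu\,\nu!\,x^{\nu+1}$. Then, as formal power series in $x$, $$\int_0^\infty \operatorname{sm}(u)e^{ -u/x}du=\cfrac{x^2}{1+\cfrac{a_1x^3}{1+\cfrac{a_2x^3}{1+\ddots}}},\quad a_{2r-1}=(3r-2)(3r-1)^2,\ a_{2r}=(3r)^2(3r+1)\ (r\ge1);$$ $$\int_0^\infty \operatorname{cm}(u)e^{ -u/x}du=\cfrac{x}{1+\cfrac{a_1x^3}{1+\cfrac{a_2x^3}{1+\ddots}}},\quad a_{2r-1}=(3r-2)^2(3r-1),\ a_{2r}=(3r-1)(3r)^2\ (r\ge1);$$ $$\int_0^\infty \operatorname{sm}(u)\operatorname{cm}(u)e^{ -u/x}du=\cfrac{x^2}{1+\cfrac{a_1x^3}{1+\cfrac{a_2x^3}{1+\ddots}}},\quad a_{2r-1}=(3r-1)^2(3r),\ a_{2r}=(3r)(3r+1)^2\ (r\ge1).$$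
   Context: The integrals denote the formal transformation from exponential to ordinary generating functions given in the claim; continued fractions are formal power series in $x$.
   Formalization: For f(u)=Σ c_ν u^ν/ν! the integral is taken as Σ c_ν x^{ν+1} (the true Laplace transform), not Σ c_ν ν! x^{ν+1}; with the extra ν! the claim fails: for cm the x^4 coefficient would be −12, while the fraction gives −2. -}

module Defs where

open import Data.Nat as ℕ using (ℕ; zero; suc; _∸_; _<_; _≤_)
open import Data.Nat.Combinatorics using (_C_)
open import Data.Integer using (ℤ; +_; -_; _+_; _*_; 0ℤ; 1ℤ)
open import Data.Vec using (Vec; []; _∷_; head)
open import Data.Product using (∃)
open import Relation.Binary.PropositionalEquality using (_≡_)

PS : Set
PS = ℕ → ℤ

sumℤ : ℕ → (ℕ → ℤ) → ℤ
sumℤ zero    f = 0ℤ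
sumℤ (suc n) f = sumℤ n f + f n

-- Exponential generating functions (Taylor data f^{(ν)}(0) of a function
-- analytic at 0).  The product of EGFs (Leibniz rule):
-- (f g)^{(n)}(0) = Σ_{k ≤ n} C(n,k) f^{(k)}(0) g^{(n-k)}(0).
egfMul : (ℕ → ℤ) → (ℕ → ℤ) → ℕ → ℤ
egfMul f g n = sumℤ (suc n) (λ k → (+ (n C k)) * (f k * g (n ∸ k)))

-- The Dixonian functions: sm, cm are given by their derivative
-- sequences at 0, satisfying sm' = cm², cm' = -sm², sm(0)=0, cm(0)=1.
IsDixonPair : (ℕ → ℤ) → (ℕ → ℤ) → Set
IsDixonPair sm cm =
  (sm 0 ≡ 0ℤ) Data.Product.× (cm 0 ≡ 1ℤ) Data.Product.×
  (∀ n → sm (suc n) ≡ egfMul cm cm n) Data.Product.×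
  (∀ n → cm (suc n) ≡ - egfMul sm sm n)

-- Formal Laplace transform: f = Σ c_ν u^ν/ν!  ↦  Σ c_ν x^{ν+1}
-- (= Σ ν! · [u^ν]f · x^{ν+1}); here f is given by c_ν = f^{(ν)}(0).
laplace : (ℕ → ℤ) → PS
laplace c zero    = 0ℤ
laplace c (suc ν) = c ν

_⊕_ : PS → PS → PS
(f ⊕ g) n = f n + g n

_⊛_ : PS → PS → PS
(f ⊛ g) n = sumℤ (suc n) (λ k → f k * g (n ∸ k))

constPS : ℤ → PS
constPS a zero    = a
constPS a (suc n) = 0ℤ

xmul : PS → PS
xmul f zero    = 0ℤ
xmul f (suc n) = f n

xpow : ℕ → PS → PS
xpow zero    f = f
xpow (suc m) f = xmul (xpow m f)

-- Inverse of a power series with constant term 1: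
-- b₀ = 1, b_n = - Σ_{k=1}^{n} f_k b_{n-k}.
-- invVec f n = b_n ∷ b_{n-1} ∷ … ∷ b_0.
private
  dot : ∀ {n} → PS → Vec ℤ n → ℤ
  dot f []       = 0ℤ
  dot f (b ∷ bs) = f 1 * b + dot (λ k → f (suc k)) bs

invVec : PS → (n : ℕ) → Vec ℤ (suc n)
invVec f zero    = 1ℤ ∷ []
invVec f (suc n) = (- dot f (invVec f n)) ∷ invVec f n

-- 1/f for f with f 0 = 1 (only used on such series below).
inv1 : PS → PS
inv1 f n = head (invVec f n)

cfTail : (ℕ → ℤ) → ℕ → ℕ → PS
cfTail a k zero    = constPS 1ℤ
cfTail a k (suc n) = inv1 (constPS 1ℤ ⊕ xpow 3 (constPS (a k) ⊛ cfTail a (suc k) n))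

convergent : ℕ → (ℕ → ℤ) → ℕ → PS
convergent m a n = xpow m (cfTail a 1 n)

-- Equality of a formal power series with the infinite continued fraction:
-- the convergents converge to F in the x-adic topology.
CFEquals : PS → ℕ → (ℕ → ℤ) → Set
CFEquals F m a =
  ∀ N → ∃ λ n₀ → ∀ n → n₀ ≤ n → ∀ i → i < N → convergent m a n i ≡ F i

-- Coefficient sequence indexed from 1: alt o e (2r-1) = o r, alt o e (2r) = e r.
alt : (ℕ → ℕ) → (ℕ → ℕ) → ℕ → ℤ
alt o e zero                   = 0ℤ
alt o e (suc zero)             = + o 1
alt o e (suc (suc zero))       = + e 1
alt o e (suc (suc (suc k)))    = alt (λ r → o (suc r)) (λ r → e (suc r)) (suc k)

{-# OPTIONS --safe #-}
module Submission where

-- Let Aₙ, Bₙ, Γₙ be the Laplace transforms of smⁿ, smⁿ cm, smⁿ cm².  Since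
-- sm³ + cm³ = 1, integration by parts gives
--   Aₙ = n x Γₙ₋₁,  Bₙ = x (n Aₙ₋₁ − (n+1) Aₙ₊₂),  Γₙ = x (n Bₙ₋₁ − (n+2) Bₙ₊₂),
-- where for n = 0 the terms n Aₙ₋₁ and n Bₙ₋₁ become 1.  Eliminating Γ leaves
-- three-term recurrences along the chains 1, A₁, B₂, A₄, B₅, …, then 1, B₀, A₂, B₃, A₅, …
-- and A₀, B₁, A₃, B₄, …; these unfold into the three continued fractions.
-- Convergence holds because the order in x of the terms of a chain tends to infinity.

open import Defs
open import Algebra.Bundles using (CommutativeRing; RawRing)
import Algebra.Solver.Ring
open import Algebra.Solver.Ring.AlmostCommutativeRing
  using (fromCommutativeRing; _-Raw-AlmostCommutative⟶_)
open import Data.Integer using (ℤ; +_; -_; 0ℤ; 1ℤ)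
  renaming (_+_ to _+ᶻ_; _*_ to _*ᶻ_; _-_ to _-ᶻ_)
import Data.Integer.Properties as ℤ
open import Data.Integer.Tactic.RingSolver using (solve-∀)
open import Data.Maybe using (Maybe; just; nothing)
open import Data.Nat using (ℕ; zero; suc; _*_; _+_; _∸_; _<_; _≤_; s≤s; s≤s⁻¹; ⌊_/2⌋)
open import Data.Nat.Combinatorics using (_C_; nCk+nC[k+1]≡[n+1]C[k+1]; k>n⇒nCk≡0)
import Data.Nat.Properties as ℕ
open import Data.Product using (_×_; _,_)
open import Data.Vec using (Vec; []; _∷_)
open import Function using (_∘_)
open import Level using (0ℓ)
open import Relation.Binary.PropositionalEquality
  using (_≡_; refl; sym; trans; cong; cong₂; module ≡-Reasoning)
open import Relation.Nullary using (yes; no)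

-- Past its head, every member of a chain has constant term 0, so quotients of neighbours are not
-- directly available as power series. What is proved instead is the product form: if U, V are
-- neighbours and T is a finite tail of the fraction, then U agrees with p x^d V T modulo a power of
-- x. Each recurrence U = p x^d V - q x^d W is followed by one for W whose leading term is g x^d′ U.
-- One level of the fraction therefore has partial numerator q g x^(d+d′). The exponent is always 3:
-- eliminating Γ costs x² in the recurrence for A, and the recurrence for B costs x. The
-- coefficients a_k are these products q g. Replacing the deepest tail by 1 does no harm, since both
-- sides of the product form vanish there to high order.

infix 4 _≈_

_≈_ : PS → PS → Set
f ≈ g = ∀ n → f n ≡ g n

tail : PS → PS
tail f n = f (suc n)

-- Finite sums

sumℤ-cong : ∀ n {f g : ℕ → ℤ} → (∀ k → k < n → f k ≡ g k) → sumℤ n f ≡ sumℤ n g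
sumℤ-cong zero    eq = refl
sumℤ-cong (suc n) eq =
  cong₂ _+ᶻ_ (sumℤ-cong n (λ k k<n → eq k (ℕ.m<n⇒m<1+n k<n))) (eq n (ℕ.n<1+n n))

sumℤ-shift : ∀ n (f : ℕ → ℤ) → sumℤ (suc n) f ≡ f 0 +ᶻ sumℤ n (f ∘ suc)
sumℤ-shift zero    f = ℤ.+-comm 0ℤ (f 0)
sumℤ-shift (suc n) f =
  trans (cong (_+ᶻ f (suc n)) (sumℤ-shift n f))
        (ℤ.+-assoc (f 0) (sumℤ n (f ∘ suc)) (f (suc n)))

sumℤ-+ : ∀ n (f g : ℕ → ℤ) → sumℤ n (λ k → f k +ᶻ g k) ≡ sumℤ n f +ᶻ sumℤ n g
sumℤ-+ zero    f g = refl
sumℤ-+ (suc n) f g =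
  trans (cong (_+ᶻ (f n +ᶻ g n)) (sumℤ-+ n f g))
        (interchange (sumℤ n f) (sumℤ n g) (f n) (g n))
  where
  interchange : ∀ a b c d → (a +ᶻ b) +ᶻ (c +ᶻ d) ≡ (a +ᶻ c) +ᶻ (b +ᶻ d)
  interchange = solve-∀

-- The Cauchy product

⊛-zero : ∀ f g → (f ⊛ g) 0 ≡ f 0 *ᶻ g 0
⊛-zero f g = ℤ.+-identityˡ _

⊛-suc : ∀ f g n → (f ⊛ g) (suc n) ≡ f 0 *ᶻ g (suc n) +ᶻ (tail f ⊛ g) n
⊛-suc f g n = sumℤ-shift (suc n) (λ k → f k *ᶻ g (suc n ∸ k))

⊛-sucʳ : ∀ f g n → (f ⊛ g) (suc n) ≡ (f ⊛ tail g) n +ᶻ f (suc n) *ᶻ g 0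
⊛-sucʳ f g n = cong₂ _+ᶻ_
  (sumℤ-cong (suc n) λ k k≤n → cong (λ m → f k *ᶻ g m) (ℕ.+-∸-assoc 1 (s≤s⁻¹ k≤n)))
  (cong (λ m → f (suc n) *ᶻ g m) (ℕ.n∸n≡0 n))

⊛-congʳ : ∀ f {g h} n → (∀ k → k ≤ n → g k ≡ h k) → (f ⊛ g) n ≡ (f ⊛ h) n
⊛-congʳ f n eq = sumℤ-cong (suc n) λ k _ → cong (f k *ᶻ_) (eq (n ∸ k) (ℕ.m∸n≤m n k))

⊛-congˡ : ∀ {f g} h → f ≈ g → f ⊛ h ≈ g ⊛ h
⊛-congˡ h eq n = sumℤ-cong (suc n) λ k _ → cong (_*ᶻ h (n ∸ k)) (eq k)

-- The term with f 0 is the first one of `f ⊛ g` and the last one of `g ⊛ f`; splitting it off on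
-- both sides leaves the same claim for `tail f`.
⊛-comm : ∀ f g → f ⊛ g ≈ g ⊛ f
⊛-comm f g zero    = cong (0ℤ +ᶻ_) (ℤ.*-comm (f 0) (g 0))
⊛-comm f g (suc n) = begin
  (f ⊛ g) (suc n)                        ≡⟨ ⊛-suc f g n ⟩
  f 0 *ᶻ g (suc n) +ᶻ (tail f ⊛ g) n   ≡⟨ ℤ.+-comm (f 0 *ᶻ g (suc n)) _ ⟩
  (tail f ⊛ g) n +ᶻ f 0 *ᶻ g (suc n)   ≡⟨ cong₂ _+ᶻ_ (⊛-comm (tail f) g n) (ℤ.*-comm (f 0) (g (suc n))) ⟩
  (g ⊛ tail f) n +ᶻ g (suc n) *ᶻ f 0   ≡⟨ ⊛-sucʳ g f n ⟨
  (g ⊛ f) (suc n)                        ∎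
  where open ≡-Reasoning

⊛-distribʳ : ∀ f g h → (f ⊕ g) ⊛ h ≈ (f ⊛ h) ⊕ (g ⊛ h)
⊛-distribʳ f g h n = trans
  (sumℤ-cong (suc n) λ k _ → ℤ.*-distribʳ-+ (h (n ∸ k)) (f k) (g k))
  (sumℤ-+ (suc n) (λ k → f k *ᶻ h (n ∸ k)) (λ k → g k *ᶻ h (n ∸ k)))

⊛-scaleˡ : ∀ a f g → (λ i → a *ᶻ f i) ⊛ g ≈ λ i → a *ᶻ (f ⊛ g) i
⊛-scaleˡ a f g n = go (suc n)
  where
  go : ∀ m → sumℤ m (λ k → a *ᶻ f k *ᶻ g (n ∸ k)) ≡ a *ᶻ sumℤ m (λ k → f k *ᶻ g (n ∸ k))
  go zero    = sym (ℤ.*-zeroʳ a)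
  go (suc m) = trans (cong₂ _+ᶻ_ (go m) (ℤ.*-assoc a (f m) _)) (sym (ℤ.*-distribˡ-+ a _ _))

-- Induction on the coefficient index, with f = f 0 + x `tail f` on both sides, replaces the
-- rearrangement of a double sum.
⊛-assoc : ∀ f g h → (f ⊛ g) ⊛ h ≈ f ⊛ (g ⊛ h)
⊛-assoc f g h zero = begin
  ((f ⊛ g) ⊛ h) 0               ≡⟨ ⊛-zero (f ⊛ g) h ⟩
  (f ⊛ g) 0 *ᶻ h 0             ≡⟨ cong (_*ᶻ h 0) (⊛-zero f g) ⟩
  f 0 *ᶻ g 0 *ᶻ h 0           ≡⟨ ℤ.*-assoc (f 0) (g 0) (h 0) ⟩
  f 0 *ᶻ (g 0 *ᶻ h 0)         ≡⟨ cong (f 0 *ᶻ_) (⊛-zero g h) ⟨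
  f 0 *ᶻ (g ⊛ h) 0             ≡⟨ ⊛-zero f (g ⊛ h) ⟨
  (f ⊛ (g ⊛ h)) 0               ∎
  where open ≡-Reasoning
⊛-assoc f g h (suc n) = begin
  ((f ⊛ g) ⊛ h) (suc n)
    ≡⟨ ⊛-suc (f ⊛ g) h n ⟩
  (f ⊛ g) 0 *ᶻ h (suc n) +ᶻ (tail (f ⊛ g) ⊛ h) n
    ≡⟨ cong₂ (λ a b → a *ᶻ h (suc n) +ᶻ b) (⊛-zero f g) tail-product ⟩
  f 0 *ᶻ g 0 *ᶻ h (suc n) +ᶻ (f 0 *ᶻ (tail g ⊛ h) n +ᶻ (tail f ⊛ (g ⊛ h)) n)
    ≡⟨ regroup (f 0) (g 0) (h (suc n)) _ _ ⟩
  f 0 *ᶻ (g 0 *ᶻ h (suc n) +ᶻ (tail g ⊛ h) n) +ᶻ (tail f ⊛ (g ⊛ h)) n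
    ≡⟨ cong (λ a → f 0 *ᶻ a +ᶻ (tail f ⊛ (g ⊛ h)) n) (⊛-suc g h n) ⟨
  f 0 *ᶻ (g ⊛ h) (suc n) +ᶻ (tail f ⊛ (g ⊛ h)) n
    ≡⟨ ⊛-suc f (g ⊛ h) n ⟨
  (f ⊛ (g ⊛ h)) (suc n) ∎
  where
  open ≡-Reasoning
  regroup : ∀ a b c d e → a *ᶻ b *ᶻ c +ᶻ (a *ᶻ d +ᶻ e) ≡ a *ᶻ (b *ᶻ c +ᶻ d) +ᶻ e
  regroup = solve-∀
  tail-product : (tail (f ⊛ g) ⊛ h) n ≡ f 0 *ᶻ (tail g ⊛ h) n +ᶻ (tail f ⊛ (g ⊛ h)) n
  tail-product = begin
    (tail (f ⊛ g) ⊛ h) n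
      ≡⟨ ⊛-congˡ h (⊛-suc f g) n ⟩
    (((λ i → f 0 *ᶻ tail g i) ⊕ (tail f ⊛ g)) ⊛ h) n
      ≡⟨ ⊛-distribʳ (λ i → f 0 *ᶻ tail g i) (tail f ⊛ g) h n ⟩
    ((λ i → f 0 *ᶻ tail g i) ⊛ h) n +ᶻ ((tail f ⊛ g) ⊛ h) n
      ≡⟨ cong₂ _+ᶻ_ (⊛-scaleˡ (f 0) (tail g) h n) (⊛-assoc (tail f) g h n) ⟩
    f 0 *ᶻ (tail g ⊛ h) n +ᶻ (tail f ⊛ (g ⊛ h)) n ∎

zero-⊛ : ∀ {f} g → (∀ n → f n ≡ 0ℤ) → ∀ n → (f ⊛ g) n ≡ 0ℤ
zero-⊛ {f} g f≈0 n = go (suc n)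
  where
  go : ∀ m → sumℤ m (λ k → f k *ᶻ g (n ∸ k)) ≡ 0ℤ
  go zero    = refl
  go (suc m) = cong₂ _+ᶻ_ (go m) (cong (_*ᶻ g (n ∸ m)) (f≈0 m))

const-⊛ : ∀ a f → constPS a ⊛ f ≈ λ i → a *ᶻ f i
const-⊛ a f zero    = ⊛-zero (constPS a) f
const-⊛ a f (suc n) = trans (⊛-suc (constPS a) f n)
  (trans (cong (a *ᶻ f (suc n) +ᶻ_) (zero-⊛ f (λ _ → refl) n)) (ℤ.+-identityʳ _))

one-⊛ : ∀ f → constPS 1ℤ ⊛ f ≈ f
one-⊛ f n = trans (const-⊛ 1ℤ f n) (ℤ.*-identityˡ (f n))

-- Multiplication by powers of x

xmul-cong : ∀ {f g} → f ≈ g → xmul f ≈ xmul g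
xmul-cong eq zero    = refl
xmul-cong eq (suc n) = eq n

xpow-cong : ∀ m {f g} → f ≈ g → xpow m f ≈ xpow m g
xpow-cong zero    eq = eq
xpow-cong (suc m) eq = xmul-cong (xpow-cong m eq)

xpow-+ : ∀ m n f → xpow m (xpow n f) ≡ xpow (m + n) f
xpow-+ zero    n f = refl
xpow-+ (suc m) n f = cong xmul (xpow-+ m n f)

xpow-scale : ∀ m a f → xpow m (λ i → a *ᶻ f i) ≈ λ i → a *ᶻ xpow m f i
xpow-scale zero    a f n       = refl
xpow-scale (suc m) a f zero    = sym (ℤ.*-zeroʳ a)
xpow-scale (suc m) a f (suc n) = xpow-scale m a f n

xpow-⊛ : ∀ m f g → xpow m f ⊛ g ≈ xpow m (f ⊛ g)
xpow-⊛ zero    f g n       = refl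
xpow-⊛ (suc m) f g zero    = refl
xpow-⊛ (suc m) f g (suc n) = trans (⊛-suc (xmul (xpow m f)) g n)
  (trans (ℤ.+-identityˡ _) (xpow-⊛ m f g n))

-- Congruence modulo powers of x

infix 4 _≡_[x^_]

_≡_[x^_] : PS → PS → ℕ → Set
f ≡ g [x^ M ] = ∀ i → i < M → f i ≡ g i

xpow-mod : ∀ m {f g M} → f ≡ g [x^ M ] → xpow m f ≡ xpow m g [x^ m + M ]
xpow-mod zero    eq i       i<M       = eq i i<M
xpow-mod (suc m) eq zero    i<M       = refl
xpow-mod (suc m) eq (suc i) (s≤s i<M) = xpow-mod m eq i i<M

⊛-mod : ∀ h {f g M} → f ≡ g [x^ M ] → h ⊛ f ≡ h ⊛ g [x^ M ]
⊛-mod h eq i i<M = ⊛-congʳ h i λ k k≤i → eq k (ℕ.≤-<-trans k≤i i<M)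

-- Inverses

-- The Vec underlying inv1, for an arbitrary series in place of inv1 f.
reversed : PS → ∀ n → Vec ℤ (suc n)
reversed b zero    = b 0 ∷ []
reversed b (suc n) = b (suc n) ∷ reversed b n

invVec-reversed : ∀ f n → invVec f n ≡ reversed (inv1 f) n
invVec-reversed f zero    = refl
invVec-reversed f (suc n) = cong (inv1 f (suc n) ∷_) (invVec-reversed f n)

mutual
  -- The hole is Defs.dot, which is private there; it is solved from inv1-dot.
  dotᵛ : PS → ∀ n → Vec ℤ (suc n) → ℤ
  dotᵛ f n v = _

  inv1-dot : ∀ f n → inv1 f (suc n) ≡ - dotᵛ f n (invVec f n)
  -- Once the vector is a variable, the hole is applied to distinct variables only, and unification
  -- determines it.
  inv1-dot f n with invVec f n
  ... | v = refl

-- The vector starts with the newest coefficient b n, which is paired with f 1; the indices run in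
-- opposite directions, as in a convolution.
dot-reversed : ∀ f b n → dotᵛ f n (reversed b n) ≡ (tail f ⊛ b) n
dot-reversed f b zero    = trans (ℤ.+-identityʳ (f 1 *ᶻ b 0)) (sym (⊛-zero (tail f) b))
dot-reversed f b (suc n) = trans
  (cong (f 1 *ᶻ b (suc n) +ᶻ_) (dot-reversed (tail f) b n))
  (sym (⊛-suc (tail f) b n))

inv1-suc : ∀ f n → inv1 f (suc n) ≡ - (tail f ⊛ inv1 f) n
inv1-suc f n = trans (inv1-dot f n)
  (cong -_ (trans (cong (dotᵛ f n) (invVec-reversed f n)) (dot-reversed f (inv1 f) n)))

⊛-inv1 : ∀ f → f 0 ≡ 1ℤ → f ⊛ inv1 f ≈ constPS 1ℤ
⊛-inv1 f f0≡1 zero    = trans (⊛-zero f (inv1 f)) (cong (_*ᶻ 1ℤ) f0≡1)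
⊛-inv1 f f0≡1 (suc n) = begin
  (f ⊛ inv1 f) (suc n)                          ≡⟨ ⊛-suc f (inv1 f) n ⟩
  f 0 *ᶻ inv1 f (suc n) +ᶻ (tail f ⊛ inv1 f) n  ≡⟨ cong (_+ᶻ (tail f ⊛ inv1 f) n)
                                                     (trans (cong₂ _*ᶻ_ f0≡1 (inv1-suc f n)) (ℤ.*-identityˡ _)) ⟩
  - (tail f ⊛ inv1 f) n +ᶻ (tail f ⊛ inv1 f) n  ≡⟨ ℤ.+-inverseˡ ((tail f ⊛ inv1 f) n) ⟩
  0ℤ                                            ∎
  where open ≡-Reasoning

-- One level of the continued fraction

-- Dividing U = αV − βW by U gives αV/U = 1 + βW/U, which is one level of the
-- fraction once W/U is known; multiplying out avoids the division by U.
fraction-step : ∀ d d′ p q g {a} (V T : PS) → d + d′ ≡ 3 → q *ᶻ g ≡ a → ∀ {M} {U W} →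
  U ≈ (λ i → p *ᶻ xpow d V i -ᶻ q *ᶻ xpow d W i) →
  W ≡ (λ i → g *ᶻ xpow d′ (U ⊛ T) i) [x^ M ] →
  U ≡ (λ i → p *ᶻ xpow d (V ⊛ inv1 (constPS 1ℤ ⊕ xpow 3 (constPS a ⊛ T))) i) [x^ M ]
fraction-step d d′ p q g V T d+d′≡3 refl {M} {U} {W} U≈ W≡ i i<M = begin
  U i                                         ≡⟨ one-⊛ U i ⟨
  (constPS 1ℤ ⊛ U) i                          ≡⟨ ⊛-congˡ U inverse i ⟨
  ((inv1 F ⊛ F) ⊛ U) i                        ≡⟨ ⊛-assoc (inv1 F) F U i ⟩
  -- Multiplying by a series preserves a congruence modulo x^M, so F U need be known only to that
  -- precision.
  (inv1 F ⊛ (F ⊛ U)) i                        ≡⟨ ⊛-mod (inv1 F) F⊛U i i<M ⟩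
  (inv1 F ⊛ (λ j → p *ᶻ xpow d V j)) i        ≡⟨ ⊛-comm (inv1 F) (λ j → p *ᶻ xpow d V j) i ⟩
  ((λ j → p *ᶻ xpow d V j) ⊛ inv1 F) i        ≡⟨ ⊛-scaleˡ p (xpow d V) (inv1 F) i ⟩
  p *ᶻ (xpow d V ⊛ inv1 F) i                  ≡⟨ cong (p *ᶻ_) (xpow-⊛ d V (inv1 F) i) ⟩
  p *ᶻ xpow d (V ⊛ inv1 F) i                  ∎
  where
  open ≡-Reasoning
  F : PS
  F = constPS 1ℤ ⊕ xpow 3 (constPS (q *ᶻ g) ⊛ T)
  inverse : inv1 F ⊛ F ≈ constPS 1ℤ
  inverse j = trans (⊛-comm (inv1 F) F j) (⊛-inv1 F refl j)
  cancel : ∀ a b q g → a -ᶻ q *ᶻ (g *ᶻ b) +ᶻ q *ᶻ g *ᶻ b ≡ a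
  cancel = solve-∀
  xW : xpow d W ≡ (λ j → g *ᶻ xpow 3 (U ⊛ T) j) [x^ M ]
  xW j j<M = begin
    xpow d W j                                  ≡⟨ xpow-mod d W≡ j (ℕ.<-≤-trans j<M (ℕ.m≤n+m M d)) ⟩
    xpow d (λ k → g *ᶻ xpow d′ (U ⊛ T) k) j     ≡⟨ xpow-scale d g (xpow d′ (U ⊛ T)) j ⟩
    g *ᶻ xpow d (xpow d′ (U ⊛ T)) j             ≡⟨ cong (λ h → g *ᶻ h j) (xpow-+ d d′ (U ⊛ T)) ⟩
    g *ᶻ xpow (d + d′) (U ⊛ T) j                ≡⟨ cong (λ m → g *ᶻ xpow m (U ⊛ T) j) d+d′≡3 ⟩
    g *ᶻ xpow 3 (U ⊛ T) j                       ∎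
  x³T⊛U : xpow 3 (constPS (q *ᶻ g) ⊛ T) ⊛ U ≈ λ j → q *ᶻ g *ᶻ xpow 3 (U ⊛ T) j
  x³T⊛U j = begin
    (xpow 3 (constPS (q *ᶻ g) ⊛ T) ⊛ U) j       ≡⟨ xpow-⊛ 3 (constPS (q *ᶻ g) ⊛ T) U j ⟩
    xpow 3 ((constPS (q *ᶻ g) ⊛ T) ⊛ U) j       ≡⟨ xpow-cong 3 scale j ⟩
    xpow 3 (λ k → q *ᶻ g *ᶻ (U ⊛ T) k) j        ≡⟨ xpow-scale 3 (q *ᶻ g) (U ⊛ T) j ⟩
    q *ᶻ g *ᶻ xpow 3 (U ⊛ T) j                  ∎
    where
    scale : (constPS (q *ᶻ g) ⊛ T) ⊛ U ≈ λ k → q *ᶻ g *ᶻ (U ⊛ T) k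
    scale k = trans (⊛-assoc (constPS (q *ᶻ g)) T U k)
      (trans (const-⊛ (q *ᶻ g) (T ⊛ U) k) (cong (q *ᶻ g *ᶻ_) (⊛-comm T U k)))
  F⊛U : F ⊛ U ≡ (λ j → p *ᶻ xpow d V j) [x^ M ]
  F⊛U j j<M = begin
    (F ⊛ U) j
      ≡⟨ ⊛-distribʳ (constPS 1ℤ) (xpow 3 (constPS (q *ᶻ g) ⊛ T)) U j ⟩
    (constPS 1ℤ ⊛ U) j +ᶻ (xpow 3 (constPS (q *ᶻ g) ⊛ T) ⊛ U) j
      ≡⟨ cong₂ _+ᶻ_ (trans (one-⊛ U j) (U≈ j)) (x³T⊛U j) ⟩
    p *ᶻ xpow d V j -ᶻ q *ᶻ xpow d W j +ᶻ q *ᶻ g *ᶻ xpow 3 (U ⊛ T) j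
      ≡⟨ cong (λ w → p *ᶻ xpow d V j -ᶻ q *ᶻ w +ᶻ q *ᶻ g *ᶻ xpow 3 (U ⊛ T) j) (xW j j<M) ⟩
    p *ᶻ xpow d V j -ᶻ q *ᶻ (g *ᶻ xpow 3 (U ⊛ T) j) +ᶻ q *ᶻ g *ᶻ xpow 3 (U ⊛ T) j
      ≡⟨ cancel (p *ᶻ xpow d V j) (xpow 3 (U ⊛ T) j) q g ⟩
    p *ᶻ xpow d V j ∎

-- Orders of vanishing and convergence along a chain

scaled-zeros : ∀ a b → a *ᶻ 0ℤ -ᶻ b *ᶻ 0ℤ ≡ 0ℤ
scaled-zeros = solve-∀

-- Only one of the m + 1 orders gained is recorded: any growth along the chain suffices for
-- convergence.
xpow-suc-vanishes : ∀ m {f N} → f ≡ (λ _ → 0ℤ) [x^ N ] → xpow (suc m) f ≡ (λ _ → 0ℤ) [x^ suc N ]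
xpow-suc-vanishes zero    f≡0 zero    i<N = refl
xpow-suc-vanishes zero    f≡0 (suc i) i<N = f≡0 i (s≤s⁻¹ i<N)
xpow-suc-vanishes (suc m) f≡0 zero    i<N = refl
xpow-suc-vanishes (suc m) f≡0 (suc i) i<N = xpow-suc-vanishes m f≡0 i (ℕ.m<n⇒m<1+n (s≤s⁻¹ i<N))

vanish-step : ∀ m a b {f g h N} → f ≈ (λ i → a *ᶻ xpow (suc m) g i -ᶻ b *ᶻ xpow (suc m) h i) →
  g ≡ (λ _ → 0ℤ) [x^ N ] → h ≡ (λ _ → 0ℤ) [x^ N ] → f ≡ (λ _ → 0ℤ) [x^ suc N ]
vanish-step m a b {f} {g} {h} f≈ g≡0 h≡0 i i<N = trans (f≈ i)
  (trans (cong₂ (λ u v → a *ᶻ u -ᶻ b *ᶻ v)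
           (xpow-suc-vanishes m g≡0 i i<N) (xpow-suc-vanishes m h≡0 i i<N))
         (scaled-zeros a b))

mod-weaken : ∀ {f g N} → f ≡ g [x^ suc N ] → f ≡ g [x^ N ]
mod-weaken eq i i<N = eq i (ℕ.m<n⇒m<1+n i<N)

scaled-vanishes : ∀ m c {f} N → f ≡ (λ _ → 0ℤ) [x^ N ] →
  (λ i → c *ᶻ xpow (suc m) (f ⊛ constPS 1ℤ) i) ≡ (λ _ → 0ℤ) [x^ N ]
scaled-vanishes m c {f} N f≡0 i i<N = trans
  (cong (c *ᶻ_) (xpow-suc-vanishes m f⊛1≡0 i (ℕ.m<n⇒m<1+n i<N)))
  (ℤ.*-zeroʳ c)
  where
  f⊛1≡0 : f ⊛ constPS 1ℤ ≡ (λ _ → 0ℤ) [x^ N ]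
  f⊛1≡0 j j<N = trans (⊛-comm f (constPS 1ℤ) j) (trans (one-⊛ f j) (f≡0 j j<N))

-- A chain is read alternately as Y 0, X 0, Y 1, X 1, and so on. Its head `Y 0` has no recurrence
-- and supplies the numerator of the whole fraction.
module TwoSequences
  (d d′ : ℕ) (p q p′ q′ : ℕ → ℤ) (X Y : ℕ → PS) (a : ℕ → ℤ)
  (d+1+d′+1≡3 : suc d + suc d′ ≡ 3)
  (X-rec : ∀ r → X r ≈ λ i → p r *ᶻ xpow (suc d) (Y r) i -ᶻ q r *ᶻ xpow (suc d) (Y (suc r)) i)
  (Y-rec : ∀ r → Y (suc r) ≈
    λ i → p′ r *ᶻ xpow (suc d′) (X r) i -ᶻ q′ r *ᶻ xpow (suc d′) (X (suc r)) i)
  (a-odd  : ∀ r → q r *ᶻ p′ r ≡ a (suc (r * 2)))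
  (a-even : ∀ r → q′ r *ᶻ p (suc r) ≡ a (suc (suc (r * 2))))
  where

  mutual
    -- The recurrences refer to index r + 1 as well, so the induction runs on the order N and not on
    -- r; the condition N ≤ r keeps it away from `Y 0` until N is 0.
    X-vanishes : ∀ N r → N ≤ r → X r ≡ (λ _ → 0ℤ) [x^ suc N ]
    X-vanishes N r N≤r = vanish-step d (p r) (q r) (X-rec r)
      (Y-vanishes N r N≤r) (Y-vanishes N (suc r) (ℕ.m≤n⇒m≤1+n N≤r))

    Y-vanishes : ∀ N r → N ≤ r → Y r ≡ (λ _ → 0ℤ) [x^ N ]
    Y-vanishes zero    r       N≤r       i ()
    Y-vanishes (suc N) (suc r) (s≤s N≤r) = vanish-step d′ (p′ r) (q′ r) (Y-rec r)
      (mod-weaken (X-vanishes N r N≤r)) (mod-weaken (X-vanishes N (suc r) (ℕ.m≤n⇒m≤1+n N≤r)))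

  mutual
    -- A level passes from X r to Y (r + 1), the next one to X (r + 1). Each pair of levels raises
    -- the index by one, and the precision with it; hence the half of n.
    X-fraction : ∀ n r → X r ≡
      (λ i → p r *ᶻ xpow (suc d) (Y r ⊛ cfTail a (suc (r * 2)) n) i) [x^ r + ⌊ n /2⌋ ]
    -- At depth 0 the tail is 1, and both sides vanish modulo x^r.
    X-fraction zero r i i<r+0 = trans (mod-weaken (X-vanishes r r ℕ.≤-refl) i i<r)
      (sym (scaled-vanishes d (p r) r (Y-vanishes r r ℕ.≤-refl) i i<r))
      where i<r = ℕ.<-≤-trans i<r+0 (ℕ.≤-reflexive (ℕ.+-identityʳ r))
    X-fraction (suc n) r =
      fraction-step (suc d) (suc d′) (p r) (q r) (p′ r) (Y r) (cfTail a (suc (suc (r * 2))) n)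
        d+1+d′+1≡3 (a-odd r) (X-rec r) (Y-fraction n r)

    Y-fraction : ∀ n r → Y (suc r) ≡
      (λ i → p′ r *ᶻ xpow (suc d′) (X r ⊛ cfTail a (suc (suc (r * 2))) n) i) [x^ r + ⌊ suc n /2⌋ ]
    Y-fraction zero r i i<r+0 = trans (mod-weaken (Y-vanishes (suc r) (suc r) ℕ.≤-refl) i i<r)
      (sym (scaled-vanishes d′ (p′ r) r (mod-weaken (X-vanishes r r ℕ.≤-refl)) i i<r))
      where i<r = ℕ.<-≤-trans i<r+0 (ℕ.≤-reflexive (ℕ.+-identityʳ r))
    Y-fraction (suc n) r i i<M =
      fraction-step (suc d′) (suc d) (p′ r) (q′ r) (p (suc r)) (X r) (cfTail a (suc (suc (suc (r * 2)))) n)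
        (trans (ℕ.+-comm (suc d′) (suc d)) d+1+d′+1≡3)
        (a-even r) (Y-rec r) (X-fraction n (suc r)) i
        (ℕ.<-≤-trans i<M (ℕ.≤-reflexive (ℕ.+-suc r ⌊ n /2⌋)))

  continued-fraction : ∀ j → p 0 ≡ 1ℤ → Y 0 ≈ xpow j (constPS 1ℤ) → CFEquals (X 0) (suc d + j) a
  -- Depth n fixes the coefficients below half of n, so depth 2N is enough for the first N.
  continued-fraction j p₀≡1 Y₀≈xʲ N = N + N , λ n N+N≤n i i<N → sym (begin
    X 0 i
      ≡⟨ X-fraction n 0 i (ℕ.<-≤-trans i<N
           (ℕ.≤-trans (ℕ.≤-reflexive (ℕ.n≡⌊n+n/2⌋ N)) (ℕ.⌊n/2⌋-mono N+N≤n))) ⟩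
    p 0 *ᶻ xpow (suc d) (Y 0 ⊛ cfTail a 1 n) i
      ≡⟨ cong (_*ᶻ xpow (suc d) (Y 0 ⊛ cfTail a 1 n) i) p₀≡1 ⟩
    1ℤ *ᶻ xpow (suc d) (Y 0 ⊛ cfTail a 1 n) i
      ≡⟨ ℤ.*-identityˡ _ ⟩
    xpow (suc d) (Y 0 ⊛ cfTail a 1 n) i
      ≡⟨ xpow-cong (suc d) (Y₀⊛ (cfTail a 1 n)) i ⟩
    xpow (suc d) (xpow j (cfTail a 1 n)) i
      ≡⟨ cong (λ f → f i) (xpow-+ (suc d) j (cfTail a 1 n)) ⟩
    convergent (suc d + j) a n i ∎)
    where
    open ≡-Reasoning
    Y₀⊛ : ∀ T → Y 0 ⊛ T ≈ xpow j T
    Y₀⊛ T i = trans (⊛-congˡ T Y₀≈xʲ i)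
      (trans (xpow-⊛ j (constPS 1ℤ) T i) (xpow-cong j (one-⊛ T) i))

-- Derivatives of sⁿ, sⁿc and sⁿc² when s′ = c² and c′ = −s²

ℤ-rawRing : RawRing 0ℓ 0ℓ
ℤ-rawRing = CommutativeRing.rawRing ℤ.+-*-commutativeRing

-- The derivatives are computed in an abstract ring, where products stay opaque. The homomorphism ι
-- brings in integer constants, whose equality is decidable, as coefficients for the solver.
module ℤ-Algebra (R : CommutativeRing 0ℓ 0ℓ)
  (ι : ℤ-rawRing -Raw-AlmostCommutative⟶ fromCommutativeRing R) where

  open CommutativeRing R renaming
    ( _+_ to infixl 6 _⊹_; _*_ to infixl 7 _∙_; -_ to infix 8 ⊝_; _≈_ to infix 4 _≋_
    ; +-cong to ⊹-cong; *-congˡ to ∙-congˡ; *-congʳ to ∙-congʳ; -‿cong to ⊝-cong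
    ; refl to ≋-refl; sym to ≋-sym; trans to ≋-trans)
  open _-Raw-AlmostCommutative⟶_ ι

  ⟦⟧-≟ : ∀ a b → Maybe (⟦ a ⟧ ≋ ⟦ b ⟧)
  ⟦⟧-≟ a b with a ℤ.≟ b
  ... | yes refl = just ≋-refl
  ... | no _     = nothing

  open Algebra.Solver.Ring ℤ-rawRing (fromCommutativeRing R) ι ⟦⟧-≟
    using (solve; _:=_; _:+_; _:*_; :-_; con)
  open import Relation.Binary.Reasoning.Setoid setoid

  κ : ℕ → Carrier
  κ n = ⟦ + n ⟧

  module Derivation (D : Carrier → Carrier)
    (D-∙ : ∀ f g → D (f ∙ g) ≋ D f ∙ g ⊹ f ∙ D g) (D-one : D (κ 1) ≋ κ 0) where

    D-square : ∀ f → D (f ∙ f) ≋ κ 2 ∙ (f ∙ D f)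
    D-square f = begin
      D (f ∙ f)           ≈⟨ D-∙ f f ⟩
      D f ∙ f ⊹ f ∙ D f   ≈⟨ solve 2 (λ f f′ → f′ :* f :+ f :* f′ := con (+ 2) :* (f :* f′)) ≋-refl f (D f) ⟩
      κ 2 ∙ (f ∙ D f)     ∎

    D-cube : ∀ f → D (f ∙ f ∙ f) ≋ κ 3 ∙ (f ∙ f ∙ D f)
    D-cube f = begin
      D (f ∙ f ∙ f)                          ≈⟨ D-∙ (f ∙ f) f ⟩
      D (f ∙ f) ∙ f ⊹ f ∙ f ∙ D f            ≈⟨ ⊹-cong (∙-congʳ (D-square f)) ≋-refl ⟩
      κ 2 ∙ (f ∙ D f) ∙ f ⊹ f ∙ f ∙ D f      ≈⟨ solve 2 (λ f f′ →
        con (+ 2) :* (f :* f′) :* f :+ f :* f :* f′ := con (+ 3) :* (f :* f :* f′)) ≋-refl f (D f) ⟩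
      κ 3 ∙ (f ∙ f ∙ D f)                    ∎

    module DixonPair (s c : Carrier) (D-s : D s ≋ c ∙ c) (D-c : D c ≋ ⊝ (s ∙ s)) where

      pow : ℕ → Carrier
      pow zero    = κ 1
      pow (suc n) = s ∙ pow n

      -- The contributions 3s²c² and -3c²s² cancel: s³ + c³ is a first integral of the system.
      D-fermat : D (s ∙ s ∙ s) ⊹ D (c ∙ c ∙ c) ≋ κ 0
      D-fermat = begin
        D (s ∙ s ∙ s) ⊹ D (c ∙ c ∙ c)
          ≈⟨ ⊹-cong (D-cube s) (D-cube c) ⟩
        κ 3 ∙ (s ∙ s ∙ D s) ⊹ κ 3 ∙ (c ∙ c ∙ D c)
          ≈⟨ ⊹-cong (∙-congˡ (∙-congˡ D-s)) (∙-congˡ (∙-congˡ D-c)) ⟩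
        κ 3 ∙ (s ∙ s ∙ (c ∙ c)) ⊹ κ 3 ∙ (c ∙ c ∙ ⊝ (s ∙ s))
          ≈⟨ solve 2 (λ s c → con (+ 3) :* (s :* s :* (c :* c)) :+ con (+ 3) :* (c :* c :* :- (s :* s))
               := con 0ℤ) ≋-refl s c ⟩
        κ 0 ∎

      D-pow : ∀ n → D (pow (suc n)) ≋ κ (suc n) ∙ (pow n ∙ (c ∙ c))
      D-pow zero = begin
        D (s ∙ κ 1)                    ≈⟨ D-∙ s (κ 1) ⟩
        D s ∙ κ 1 ⊹ s ∙ D (κ 1)        ≈⟨ ⊹-cong (∙-congʳ D-s) (∙-congˡ D-one) ⟩
        c ∙ c ∙ κ 1 ⊹ s ∙ κ 0          ≈⟨ solve 2 (λ s c →
          c :* c :* con 1ℤ :+ s :* con 0ℤ := con 1ℤ :* (con 1ℤ :* (c :* c))) ≋-refl s c ⟩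
        κ 1 ∙ (κ 1 ∙ (c ∙ c))          ∎
      D-pow (suc n) = begin
        D (s ∙ pow (suc n))
          ≈⟨ D-∙ s (pow (suc n)) ⟩
        D s ∙ pow (suc n) ⊹ s ∙ D (pow (suc n))
          ≈⟨ ⊹-cong (∙-congʳ D-s) (∙-congˡ (D-pow n)) ⟩
        c ∙ c ∙ (s ∙ pow n) ⊹ s ∙ (κ (suc n) ∙ (pow n ∙ (c ∙ c)))
          ≈⟨ solve 4 (λ s c P k → c :* c :* (s :* P) :+ s :* (k :* (P :* (c :* c)))
               := (con 1ℤ :+ k) :* (s :* P :* (c :* c))) ≋-refl s c (pow n) (κ (suc n)) ⟩
        (κ 1 ⊹ κ (suc n)) ∙ (pow (suc n) ∙ (c ∙ c))
          ≈⟨ ∙-congʳ (+-homo 1ℤ (+ suc n)) ⟨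
        κ (suc (suc n)) ∙ (pow (suc n) ∙ (c ∙ c)) ∎

      -- The power s⁰ is treated apart, here and in `D-c²`: its derivative is 0, so the term with
      -- the lower power of s is missing.
      D-c′ : D (pow 0 ∙ c) ≋ ⊝ (κ 1 ∙ pow 2)
      D-c′ = begin
        D (κ 1 ∙ c)                    ≈⟨ D-∙ (κ 1) c ⟩
        D (κ 1) ∙ c ⊹ κ 1 ∙ D c        ≈⟨ ⊹-cong (∙-congʳ D-one) (∙-congˡ D-c) ⟩
        κ 0 ∙ c ⊹ κ 1 ∙ ⊝ (s ∙ s)      ≈⟨ solve 2 (λ s c →
          con 0ℤ :* c :+ con 1ℤ :* :- (s :* s) := :- (con 1ℤ :* (s :* (s :* con 1ℤ)))) ≋-refl s c ⟩
        ⊝ (κ 1 ∙ pow 2)                ∎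

      D-c² : D (pow 0 ∙ (c ∙ c)) ≋ ⊝ (κ 2 ∙ (pow 2 ∙ c))
      D-c² = begin
        D (κ 1 ∙ (c ∙ c))
          ≈⟨ D-∙ (κ 1) (c ∙ c) ⟩
        D (κ 1) ∙ (c ∙ c) ⊹ κ 1 ∙ D (c ∙ c)
          ≈⟨ ⊹-cong (∙-congʳ D-one) (∙-congˡ (≋-trans (D-square c) (∙-congˡ (∙-congˡ D-c)))) ⟩
        κ 0 ∙ (c ∙ c) ⊹ κ 1 ∙ (κ 2 ∙ (c ∙ ⊝ (s ∙ s)))
          ≈⟨ solve 2 (λ s c → con 0ℤ :* (c :* c) :+ con 1ℤ :* (con (+ 2) :* (c :* :- (s :* s)))
               := :- (con (+ 2) :* (s :* (s :* con 1ℤ) :* c))) ≋-refl s c ⟩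
        ⊝ (κ 2 ∙ (pow 2 ∙ c)) ∎

      module _ (fermat : s ∙ s ∙ s ⊹ c ∙ c ∙ c ≋ κ 1) where

        D-pow-c : ∀ n → D (pow (suc n) ∙ c) ≋ κ (1 + n) ∙ pow n ⊹ ⊝ (κ (2 + n) ∙ pow (3 + n))
        D-pow-c n = begin
          D (pow (suc n) ∙ c)
            ≈⟨ D-∙ (pow (suc n)) c ⟩
          D (pow (suc n)) ∙ c ⊹ pow (suc n) ∙ D c
            ≈⟨ ⊹-cong (∙-congʳ (D-pow n)) (∙-congˡ D-c) ⟩
          κ (1 + n) ∙ (pow n ∙ (c ∙ c)) ∙ c ⊹ s ∙ pow n ∙ ⊝ (s ∙ s)
            -- Writing c³ as (s³ + c³) - s³ adds k to the coefficient 1 of the term in s³ P.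
            ≈⟨ solve 4 (λ s c P k → k :* (P :* (c :* c)) :* c :+ s :* P :* :- (s :* s)
                 := k :* P :* (s :* s :* s :+ c :* c :* c) :+ :- ((con 1ℤ :+ k) :* (s :* (s :* (s :* P)))))
                 ≋-refl s c (pow n) (κ (1 + n)) ⟩
          κ (1 + n) ∙ pow n ∙ (s ∙ s ∙ s ⊹ c ∙ c ∙ c) ⊹ ⊝ ((κ 1 ⊹ κ (1 + n)) ∙ pow (3 + n))
            ≈⟨ ⊹-cong (∙-congˡ fermat) (⊝-cong (∙-congʳ (≋-sym (+-homo 1ℤ (+ suc n))))) ⟩
          κ (1 + n) ∙ pow n ∙ κ 1 ⊹ ⊝ (κ (2 + n) ∙ pow (3 + n))
            ≈⟨ ⊹-cong (solve 1 (λ f → f :* con 1ℤ := f) ≋-refl (κ (1 + n) ∙ pow n)) ≋-refl ⟩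
          κ (1 + n) ∙ pow n ⊹ ⊝ (κ (2 + n) ∙ pow (3 + n)) ∎

        D-pow-c² : ∀ n → D (pow (suc n) ∙ (c ∙ c)) ≋
          κ (1 + n) ∙ (pow n ∙ c) ⊹ ⊝ (κ (3 + n) ∙ (pow (3 + n) ∙ c))
        D-pow-c² n = begin
          D (pow (suc n) ∙ (c ∙ c))
            ≈⟨ D-∙ (pow (suc n)) (c ∙ c) ⟩
          D (pow (suc n)) ∙ (c ∙ c) ⊹ pow (suc n) ∙ D (c ∙ c)
            ≈⟨ ⊹-cong (∙-congʳ (D-pow n)) (∙-congˡ (≋-trans (D-square c) (∙-congˡ (∙-congˡ D-c)))) ⟩
          κ (1 + n) ∙ (pow n ∙ (c ∙ c)) ∙ (c ∙ c) ⊹ s ∙ pow n ∙ (κ 2 ∙ (c ∙ ⊝ (s ∙ s)))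
            -- Here c⁴ is c (s³ + c³) - c s³, and k joins the 2 that comes from differentiating c².
            ≈⟨ solve 4 (λ s c P k →
                 k :* (P :* (c :* c)) :* (c :* c) :+ s :* P :* (con (+ 2) :* (c :* :- (s :* s)))
                 := k :* (P :* c) :* (s :* s :* s :+ c :* c :* c)
                    :+ :- ((con (+ 2) :+ k) :* (s :* (s :* (s :* P)) :* c)))
                 ≋-refl s c (pow n) (κ (1 + n)) ⟩
          κ (1 + n) ∙ (pow n ∙ c) ∙ (s ∙ s ∙ s ⊹ c ∙ c ∙ c) ⊹ ⊝ ((κ 2 ⊹ κ (1 + n)) ∙ (pow (3 + n) ∙ c))
            ≈⟨ ⊹-cong (∙-congˡ fermat) (⊝-cong (∙-congʳ (≋-sym (+-homo (+ 2) (+ suc n))))) ⟩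
          κ (1 + n) ∙ (pow n ∙ c) ∙ κ 1 ⊹ ⊝ (κ (3 + n) ∙ (pow (3 + n) ∙ c))
            ≈⟨ ⊹-cong (solve 1 (λ f → f :* con 1ℤ := f) ≋-refl (κ (1 + n) ∙ (pow n ∙ c))) ≋-refl ⟩
          κ (1 + n) ∙ (pow n ∙ c) ⊹ ⊝ (κ (3 + n) ∙ (pow (3 + n) ∙ c)) ∎

-- The ring of exponential generating functions, with derivation tail

egfMul-zero : ∀ f g → egfMul f g 0 ≡ f 0 *ᶻ g 0
egfMul-zero f g = trans (ℤ.+-identityˡ _) (ℤ.*-identityˡ _)

egfMul-cong : ∀ {f f′ g g′} → f ≈ f′ → g ≈ g′ → egfMul f g ≈ egfMul f′ g′
egfMul-cong f≈f′ g≈g′ n =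
  sumℤ-cong (suc n) λ k _ → cong (+ (n C k) *ᶻ_) (cong₂ _*ᶻ_ (f≈f′ k) (g≈g′ (n ∸ k)))

-- Pascal's rule splits each term with positive index. The second halves, together with the term of
-- index 0, form the other product up to one extra term, whose binomial coefficient is 0.
leibniz : ∀ f g → tail (egfMul f g) ≈ egfMul (tail f) g ⊕ egfMul f (tail g)
leibniz f g n = begin
  egfMul f g (suc n)
    ≡⟨ sumℤ-shift (suc n) (λ k → + (suc n C k) *ᶻ (f k *ᶻ g (suc n ∸ k))) ⟩
  u +ᶻ sumℤ (suc n) (λ k → + (suc n C suc k) *ᶻ w k)
    ≡⟨ cong (u +ᶻ_) (sumℤ-cong (suc n) λ k _ → pascal k) ⟩
  u +ᶻ sumℤ (suc n) (λ k → + (n C k) *ᶻ w k +ᶻ + (n C suc k) *ᶻ w k)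
    ≡⟨ cong (u +ᶻ_) (sumℤ-+ (suc n) (λ k → + (n C k) *ᶻ w k) (λ k → + (n C suc k) *ᶻ w k)) ⟩
  u +ᶻ (egfMul (tail f) g n +ᶻ sumℤ (suc n) (λ k → + (n C suc k) *ᶻ w k))
    ≡⟨ swap u (egfMul (tail f) g n) _ ⟩
  egfMul (tail f) g n +ᶻ (u +ᶻ sumℤ (suc n) (λ k → + (n C suc k) *ᶻ w k))
    ≡⟨ cong (egfMul (tail f) g n +ᶻ_) (sumℤ-shift (suc n) (λ k → + (n C k) *ᶻ (f k *ᶻ g (suc n ∸ k)))) ⟨
  egfMul (tail f) g n +ᶻ sumℤ (suc (suc n)) (λ k → + (n C k) *ᶻ (f k *ᶻ g (suc n ∸ k)))
    ≡⟨ cong (egfMul (tail f) g n +ᶻ_) (cong₂ _+ᶻ_ (sumℤ-cong (suc n) inner) last) ⟩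
  egfMul (tail f) g n +ᶻ (egfMul f (tail g) n +ᶻ 0ℤ)
    ≡⟨ cong (egfMul (tail f) g n +ᶻ_) (ℤ.+-identityʳ (egfMul f (tail g) n)) ⟩
  egfMul (tail f) g n +ᶻ egfMul f (tail g) n ∎
  where
  open ≡-Reasoning
  u : ℤ
  u = 1ℤ *ᶻ (f 0 *ᶻ g (suc n))
  w : ℕ → ℤ
  w k = f (suc k) *ᶻ g (n ∸ k)
  pascal : ∀ k → + (suc n C suc k) *ᶻ w k ≡ + (n C k) *ᶻ w k +ᶻ + (n C suc k) *ᶻ w k
  pascal k = trans
    (cong (λ m → + m *ᶻ w k) (sym (nCk+nC[k+1]≡[n+1]C[k+1] n k)))
    (ℤ.*-distribʳ-+ (w k) (+ (n C k)) (+ (n C suc k)))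
  swap : ∀ a b c → a +ᶻ (b +ᶻ c) ≡ b +ᶻ (a +ᶻ c)
  swap = solve-∀
  inner : ∀ k → k < suc n → + (n C k) *ᶻ (f k *ᶻ g (suc n ∸ k)) ≡ + (n C k) *ᶻ (f k *ᶻ tail g (n ∸ k))
  inner k (s≤s k≤n) = cong (λ m → + (n C k) *ᶻ (f k *ᶻ g m)) (ℕ.+-∸-assoc 1 k≤n)
  last : + (n C suc n) *ᶻ (f (suc n) *ᶻ g (n ∸ n)) ≡ 0ℤ
  last = cong (λ m → + m *ᶻ (f (suc n) *ᶻ g (n ∸ n))) (k>n⇒nCk≡0 (ℕ.n<1+n n))

egfMul-comm : ∀ f g → egfMul f g ≈ egfMul g f
egfMul-comm f g zero    = cong (λ a → 0ℤ +ᶻ 1ℤ *ᶻ a) (ℤ.*-comm (f 0) (g 0))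
egfMul-comm f g (suc n) = begin
  egfMul f g (suc n)                          ≡⟨ leibniz f g n ⟩
  egfMul (tail f) g n +ᶻ egfMul f (tail g) n  ≡⟨ cong₂ _+ᶻ_ (egfMul-comm (tail f) g n) (egfMul-comm f (tail g) n) ⟩
  egfMul g (tail f) n +ᶻ egfMul (tail g) f n  ≡⟨ ℤ.+-comm (egfMul g (tail f) n) _ ⟩
  egfMul (tail g) f n +ᶻ egfMul g (tail f) n  ≡⟨ leibniz g f n ⟨
  egfMul g f (suc n)                          ∎
  where open ≡-Reasoning

egfMul-distribʳ : ∀ h f g → egfMul (f ⊕ g) h ≈ egfMul f h ⊕ egfMul g h
egfMul-distribʳ h f g n = trans
  (sumℤ-cong (suc n) λ k _ → distrib (+ (n C k)) (f k) (g k) (h (n ∸ k)))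
  (sumℤ-+ (suc n) (λ k → + (n C k) *ᶻ (f k *ᶻ h (n ∸ k))) (λ k → + (n C k) *ᶻ (g k *ᶻ h (n ∸ k))))
  where
  distrib : ∀ a b c d → a *ᶻ ((b +ᶻ c) *ᶻ d) ≡ a *ᶻ (b *ᶻ d) +ᶻ a *ᶻ (c *ᶻ d)
  distrib = solve-∀

egfMul-distribˡ : ∀ h f g → egfMul h (f ⊕ g) ≈ egfMul h f ⊕ egfMul h g
egfMul-distribˡ h f g n = trans (egfMul-comm h (f ⊕ g) n)
  (trans (egfMul-distribʳ h f g n) (cong₂ _+ᶻ_ (egfMul-comm f h n) (egfMul-comm g h n)))

-- Both sides have the same constant term, and by `leibniz` their derivatives are sums of the same
-- three smaller instances; no identity between products of binomials is needed.
egfMul-assoc : ∀ f g h → egfMul (egfMul f g) h ≈ egfMul f (egfMul g h)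
egfMul-assoc f g h zero = begin
  egfMul (egfMul f g) h 0      ≡⟨ egfMul-zero (egfMul f g) h ⟩
  egfMul f g 0 *ᶻ h 0          ≡⟨ cong (_*ᶻ h 0) (egfMul-zero f g) ⟩
  f 0 *ᶻ g 0 *ᶻ h 0            ≡⟨ ℤ.*-assoc (f 0) (g 0) (h 0) ⟩
  f 0 *ᶻ (g 0 *ᶻ h 0)          ≡⟨ cong (f 0 *ᶻ_) (egfMul-zero g h) ⟨
  f 0 *ᶻ egfMul g h 0          ≡⟨ egfMul-zero f (egfMul g h) ⟨
  egfMul f (egfMul g h) 0      ∎
  where open ≡-Reasoning
egfMul-assoc f g h (suc n) = begin
  egfMul (egfMul f g) h (suc n)
    ≡⟨ leibniz (egfMul f g) h n ⟩
  egfMul (tail (egfMul f g)) h n +ᶻ egfMul (egfMul f g) (tail h) n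
    ≡⟨ cong (_+ᶻ egfMul (egfMul f g) (tail h) n) (egfMul-cong {g = h} (leibniz f g) (λ _ → refl) n) ⟩
  egfMul (egfMul (tail f) g ⊕ egfMul f (tail g)) h n +ᶻ egfMul (egfMul f g) (tail h) n
    ≡⟨ cong (_+ᶻ egfMul (egfMul f g) (tail h) n) (egfMul-distribʳ h (egfMul (tail f) g) (egfMul f (tail g)) n) ⟩
  egfMul (egfMul (tail f) g) h n +ᶻ egfMul (egfMul f (tail g)) h n +ᶻ egfMul (egfMul f g) (tail h) n
    ≡⟨ cong₂ _+ᶻ_ (cong₂ _+ᶻ_ (egfMul-assoc (tail f) g h n) (egfMul-assoc f (tail g) h n))
                  (egfMul-assoc f g (tail h) n) ⟩
  egfMul (tail f) (egfMul g h) n +ᶻ egfMul f (egfMul (tail g) h) n +ᶻ egfMul f (egfMul g (tail h)) n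
    ≡⟨ ℤ.+-assoc (egfMul (tail f) (egfMul g h) n) (egfMul f (egfMul (tail g) h) n) _ ⟩
  egfMul (tail f) (egfMul g h) n +ᶻ (egfMul f (egfMul (tail g) h) n +ᶻ egfMul f (egfMul g (tail h)) n)
    ≡⟨ cong (egfMul (tail f) (egfMul g h) n +ᶻ_) (egfMul-distribˡ f (egfMul (tail g) h) (egfMul g (tail h)) n) ⟨
  egfMul (tail f) (egfMul g h) n +ᶻ egfMul f (egfMul (tail g) h ⊕ egfMul g (tail h)) n
    ≡⟨ cong (egfMul (tail f) (egfMul g h) n +ᶻ_) (egfMul-cong {f} (λ _ → refl) (leibniz g h) n) ⟨
  egfMul (tail f) (egfMul g h) n +ᶻ egfMul f (tail (egfMul g h)) n
    ≡⟨ leibniz f (egfMul g h) n ⟨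
  egfMul f (egfMul g h) (suc n) ∎
  where open ≡-Reasoning

zero-egfMul : ∀ {f} g → f ≈ (λ _ → 0ℤ) → egfMul f g ≈ λ _ → 0ℤ
zero-egfMul {f} g f≈0 zero    = trans (egfMul-zero f g) (cong (_*ᶻ g 0) (f≈0 0))
zero-egfMul {f} g f≈0 (suc n) = trans (leibniz f g n)
  (cong₂ _+ᶻ_ (zero-egfMul g (f≈0 ∘ suc) n) (zero-egfMul (tail g) f≈0 n))

const-egfMul : ∀ a f → egfMul (constPS a) f ≈ λ n → a *ᶻ f n
const-egfMul a f zero    = egfMul-zero (constPS a) f
const-egfMul a f (suc n) = trans (leibniz (constPS a) f n)
  (trans (cong₂ _+ᶻ_ (zero-egfMul f (λ _ → refl) n) (const-egfMul a (tail f) n))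
         (ℤ.+-identityˡ (a *ᶻ f (suc n))))

egfMul-identityˡ : ∀ f → egfMul (constPS 1ℤ) f ≈ f
egfMul-identityˡ f n = trans (const-egfMul 1ℤ f n) (ℤ.*-identityˡ (f n))

egfMul-identityʳ : ∀ f → egfMul f (constPS 1ℤ) ≈ f
egfMul-identityʳ f n = trans (egfMul-comm f (constPS 1ℤ) n) (egfMul-identityˡ f n)

egfRing : CommutativeRing 0ℓ 0ℓ
egfRing = record
  { Carrier = PS
  ; _≈_ = _≈_
  ; _+_ = _⊕_
  ; _*_ = egfMul
  ; -_ = λ f n → - f n
  ; 0# = λ _ → 0ℤ
  ; 1# = constPS 1ℤ
  ; isCommutativeRing = record
    { isRing = record
      { +-isAbelianGroup = record
        { isGroup = record
          { isMonoid = record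
            { isSemigroup = record
              { isMagma = record
                { isEquivalence = record
                  { refl = λ _ → refl
                  ; sym = λ eq n → sym (eq n)
                  ; trans = λ eq eq′ n → trans (eq n) (eq′ n)
                  }
                ; ∙-cong = λ eq eq′ n → cong₂ _+ᶻ_ (eq n) (eq′ n)
                }
              ; assoc = λ f g h n → ℤ.+-assoc (f n) (g n) (h n)
              }
            ; identity = (λ f n → ℤ.+-identityˡ (f n)) , (λ f n → ℤ.+-identityʳ (f n))
            }
          ; inverse = (λ f n → ℤ.+-inverseˡ (f n)) , (λ f n → ℤ.+-inverseʳ (f n))
          ; ⁻¹-cong = λ eq n → cong -_ (eq n)
          }
        ; comm = λ f g n → ℤ.+-comm (f n) (g n)
        }
      ; *-cong = egfMul-cong
      ; *-assoc = egfMul-assoc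
      ; *-identity = egfMul-identityˡ , egfMul-identityʳ
      ; distrib = egfMul-distribˡ , egfMul-distribʳ
      }
    ; *-comm = egfMul-comm
    }
  }

constHom : ℤ-rawRing -Raw-AlmostCommutative⟶ fromCommutativeRing egfRing
constHom = record
  { ⟦_⟧ = constPS
  ; +-homo = λ where
      a b zero    → refl
      a b (suc n) → refl
  ; *-homo = λ where
      a b zero    → sym (egfMul-zero (constPS a) (constPS b))
      a b (suc n) → sym (trans (const-egfMul a (constPS b) (suc n)) (ℤ.*-zeroʳ a))
  ; -‿homo = λ where
      a zero    → refl
      a (suc n) → refl
  ; 0-homo = λ where
      zero    → refl
      (suc n) → refl
  ; 1-homo = λ _ → refl
  }

-- Since `tail (constPS 1ℤ)` computes to 0 at every index, this also says that the derivative of 1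
-- is 0.
zero-const : (λ _ → 0ℤ) ≈ constPS 0ℤ
zero-const zero    = refl
zero-const (suc n) = refl

-- The Laplace transform

laplace-cong : ∀ {f g} → f ≈ g → laplace f ≈ laplace g
laplace-cong eq zero    = refl
laplace-cong eq (suc n) = eq n

laplace-one : laplace (constPS 1ℤ) ≈ xpow 1 (constPS 1ℤ)
laplace-one zero    = refl
laplace-one (suc n) = refl

-- Integration by parts: the transform of f is x f(0) plus x times the transform of f′, and here the
-- boundary term is 0. In `laplace-parts₁` it is x, so the series 1 takes the place of the first
-- transform.
laplace-parts : ∀ p q {f g h} → f 0 ≡ 0ℤ → (∀ n → tail f n ≡ p *ᶻ g n -ᶻ q *ᶻ h n) →
  laplace f ≈ λ i → p *ᶻ xpow 1 (laplace g) i -ᶻ q *ᶻ xpow 1 (laplace h) i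
laplace-parts p q f₀ f′ zero          = sym (scaled-zeros p q)
laplace-parts p q f₀ f′ (suc zero)    = trans f₀ (sym (scaled-zeros p q))
laplace-parts p q f₀ f′ (suc (suc n)) = f′ n

laplace-parts₁ : ∀ q {f h} → f 0 ≡ 1ℤ → (∀ n → tail f n ≡ - (q *ᶻ h n)) →
  laplace f ≈ λ i → 1ℤ *ᶻ xpow 1 (constPS 1ℤ) i -ᶻ q *ᶻ xpow 1 (laplace h) i
laplace-parts₁ q f₀ f′ zero          = sym (scaled-zeros 1ℤ q)
laplace-parts₁ q f₀ f′ (suc zero)    = trans f₀ (cong (λ z → 1ℤ -ᶻ z) (sym (ℤ.*-zeroʳ q)))
laplace-parts₁ q f₀ f′ (suc (suc n)) = trans (f′ n) (sym (ℤ.+-identityˡ _))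

-- This is the elimination of Γ, in the role of k: one factor x comes from f′ = m k, the other from
-- the recurrence of k.
laplace-parts² : ∀ m p q {f k G H} → f 0 ≡ 0ℤ → (∀ n → tail f n ≡ m *ᶻ k n) →
  laplace k ≈ (λ i → p *ᶻ xpow 1 G i -ᶻ q *ᶻ xpow 1 H i) →
  laplace f ≈ λ i → m *ᶻ p *ᶻ xpow 2 G i -ᶻ m *ᶻ q *ᶻ xpow 2 H i
laplace-parts² m p q f₀ f′ k≈ zero       = sym (scaled-zeros (m *ᶻ p) (m *ᶻ q))
laplace-parts² m p q f₀ f′ k≈ (suc zero) = trans f₀ (sym (scaled-zeros (m *ᶻ p) (m *ᶻ q)))
laplace-parts² m p q {G = G} {H} f₀ f′ k≈ (suc (suc n)) =
  trans (f′ n) (trans (cong (m *ᶻ_) (k≈ (suc n))) (distrib m p q (G n) (H n)))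
  where
  distrib : ∀ m p q g h → m *ᶻ (p *ᶻ g -ᶻ q *ᶻ h) ≡ m *ᶻ p *ᶻ g -ᶻ m *ᶻ q *ᶻ h
  distrib = solve-∀

-- Laplace transforms of smⁿ, smⁿcm and smⁿcm²

module Dixon (sm cm : ℕ → ℤ) (sm₀ : sm 0 ≡ 0ℤ) (cm₀ : cm 0 ≡ 1ℤ)
  (sm′ : ∀ n → sm (suc n) ≡ egfMul cm cm n) (cm′ : ∀ n → cm (suc n) ≡ - egfMul sm sm n)
  where

  open ℤ-Algebra egfRing constHom using (κ; module Derivation)
  open Derivation tail leibniz zero-const using (module DixonPair)
  open DixonPair sm cm sm′ cm′

  -- The value at 0 is 0 + 1, and all later coefficients are coefficients of the derivative, which
  -- is 0.
  fermat : egfMul (egfMul sm sm) sm ⊕ egfMul (egfMul cm cm) cm ≈ constPS 1ℤ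
  fermat zero    = cong₂ _+ᶻ_ (cube-at-0 sm sm₀) (cube-at-0 cm cm₀)
    where
    cube-at-0 : ∀ f {a} → f 0 ≡ a → egfMul (egfMul f f) f 0 ≡ a *ᶻ a *ᶻ a
    cube-at-0 f refl = trans (egfMul-zero (egfMul f f) f) (cong (_*ᶻ f 0) (egfMul-zero f f))
  fermat (suc n) = trans (D-fermat n) (sym (zero-const n))

  A B Γ : ℕ → PS
  A n = laplace (pow n)
  B n = laplace (egfMul (pow n) cm)
  Γ n = laplace (egfMul (pow n) (egfMul cm cm))

  pow-suc-vanishes : ∀ n f → egfMul (pow (suc n)) f 0 ≡ 0ℤ
  pow-suc-vanishes n f = trans (egfMul-zero (pow (suc n)) f)
    (cong (_*ᶻ f 0) (trans (egfMul-zero sm (pow n)) (cong (_*ᶻ pow n 0) sm₀)))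

  linear : ∀ p q g h → egfMul (κ p) g ⊕ (λ n → - egfMul (κ q) h n) ≈ λ n → + p *ᶻ g n -ᶻ + q *ᶻ h n
  linear p q g h n = cong₂ _-ᶻ_ (const-egfMul (+ p) g n) (const-egfMul (+ q) h n)

  B-zero : B 0 ≈ λ i → 1ℤ *ᶻ xpow 1 (constPS 1ℤ) i -ᶻ 1ℤ *ᶻ xpow 1 (A 2) i
  B-zero = laplace-parts₁ 1ℤ (trans (egfMul-zero (κ 1) cm) (cong (1ℤ *ᶻ_) cm₀))
    λ n → trans (D-c′ n) (cong -_ (const-egfMul 1ℤ (pow 2) n))

  B-suc : ∀ n → B (suc n) ≈ λ i → + (1 + n) *ᶻ xpow 1 (A n) i -ᶻ + (2 + n) *ᶻ xpow 1 (A (3 + n)) i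
  B-suc n = laplace-parts (+ (1 + n)) (+ (2 + n)) (pow-suc-vanishes n cm)
    λ i → trans (D-pow-c fermat n i) (linear (1 + n) (2 + n) (pow n) (pow (3 + n)) i)

  Γ-zero : Γ 0 ≈ λ i → 1ℤ *ᶻ xpow 1 (constPS 1ℤ) i -ᶻ + 2 *ᶻ xpow 1 (B 2) i
  Γ-zero = laplace-parts₁ (+ 2)
    (trans (egfMul-zero (κ 1) (egfMul cm cm)) (cong (1ℤ *ᶻ_) (trans (egfMul-zero cm cm) (cong₂ _*ᶻ_ cm₀ cm₀))))
    λ n → trans (D-c² n) (cong -_ (const-egfMul (+ 2) (egfMul (pow 2) cm) n))

  Γ-suc : ∀ n → Γ (suc n) ≈
    λ i → + (1 + n) *ᶻ xpow 1 (B n) i -ᶻ + (3 + n) *ᶻ xpow 1 (B (3 + n)) i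
  Γ-suc n = laplace-parts (+ (1 + n)) (+ (3 + n)) (pow-suc-vanishes n (egfMul cm cm))
    λ i → trans (D-pow-c² fermat n i)
      (linear (1 + n) (3 + n) (egfMul (pow n) cm) (egfMul (pow (3 + n)) cm) i)

  -- The recurrence of `Γ n` is a parameter, so that `Γ-zero`, with the series 1 in place of a
  -- transform, fits as well as `Γ-suc`.
  A-suc : ∀ n p q {G H} → Γ n ≈ (λ i → p *ᶻ xpow 1 G i -ᶻ q *ᶻ xpow 1 H i) →
    A (suc n) ≈ λ i → + (1 + n) *ᶻ p *ᶻ xpow 2 G i -ᶻ + (1 + n) *ᶻ q *ᶻ xpow 2 H i
  A-suc n p q = laplace-parts² (+ (1 + n)) p q
    (trans (egfMul-zero sm (pow n)) (cong (_*ᶻ pow n 0) sm₀))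
    λ i → trans (D-pow n i) (const-egfMul (+ (1 + n)) (egfMul (pow n) (egfMul cm cm)) i)

-- The three continued fractions

-- The chains yield transforms of products such as sm times 1, which agree with the desired ones
-- coefficient by coefficient.
CFEquals-resp : ∀ m a {F G} → F ≈ G → CFEquals F m a → CFEquals G m a
CFEquals-resp m a F≈G cf N with cf N
... | n₀ , conv = n₀ , λ n n₀≤n i i<N → trans (conv n n₀≤n i i<N) (F≈G i)

alt-odd : ∀ o e r → alt o e (suc (r * 2)) ≡ + o (suc r)
alt-odd o e zero    = refl
alt-odd o e (suc r) = alt-odd (o ∘ suc) (e ∘ suc) r

alt-even : ∀ o e r → alt o e (suc (suc (r * 2))) ≡ + e (suc r)
alt-even o e zero    = refl
alt-even o e (suc r) = alt-even (o ∘ suc) (e ∘ suc) r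

-- Unlike 3 * suc r, suc r * 3 computes to 3 + r * 3.
via-*-comm : (f : ℕ → ℕ) → ∀ r → + f (3 + r * 3) ≡ + f (3 * suc r)
via-*-comm f r = cong (λ m → + f m) (ℕ.*-comm (suc r) 3)

pos-*-square : ∀ a b → + a *ᶻ + b *ᶻ + b ≡ + (a * (b * b))
pos-*-square a b = begin
  + a *ᶻ + b *ᶻ + b      ≡⟨ ℤ.*-assoc (+ a) (+ b) (+ b) ⟩
  + a *ᶻ (+ b *ᶻ + b)    ≡⟨ cong (+ a *ᶻ_) (ℤ.pos-* b b) ⟨
  + a *ᶻ + (b * b)       ≡⟨ ℤ.pos-* a (b * b) ⟨
  + (a * (b * b))        ∎
  where open ≡-Reasoning

pos-square-* : ∀ a b → + a *ᶻ (+ b *ᶻ + a) ≡ + (a * a * b)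
pos-square-* a b = begin
  + a *ᶻ (+ b *ᶻ + a)    ≡⟨ ℤ.*-comm (+ a) (+ b *ᶻ + a) ⟩
  + b *ᶻ + a *ᶻ + a      ≡⟨ pos-*-square b a ⟩
  + (b * (a * a))        ≡⟨ cong +_ (ℕ.*-comm b (a * a)) ⟩
  + (a * a * b)          ∎
  where open ≡-Reasoning

module Fractions (sm cm : ℕ → ℤ) (sm₀ : sm 0 ≡ 0ℤ) (cm₀ : cm 0 ≡ 1ℤ)
  (sm′ : ∀ n → sm (suc n) ≡ egfMul cm cm n) (cm′ : ∀ n → cm (suc n) ≡ - egfMul sm sm n)
  where
  open Dixon sm cm sm₀ cm₀ sm′ cm′

  sm-fraction : CFEquals (laplace sm) 2
    (alt (λ r → (3 * r ∸ 2) * ((3 * r ∸ 1) * (3 * r ∸ 1))) (λ r → ((3 * r) * (3 * r)) * (3 * r + 1)))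
  sm-fraction = CFEquals-resp 2 a (laplace-cong (egfMul-identityʳ sm))
    -- The recurrence of A carries x² and that of B carries x; each parameter is one less than the
    -- exponent.
    (TwoSequences.continued-fraction 1 0 p q p′ q′ X Y a refl X-rec Y-rec a-odd a-even
      0 refl (λ _ → refl))
    where
    o e : ℕ → ℕ
    o r = (3 * r ∸ 2) * ((3 * r ∸ 1) * (3 * r ∸ 1))
    e r = ((3 * r) * (3 * r)) * (3 * r + 1)
    a = alt o e
    X Y : ℕ → PS
    X r       = A (1 + r * 3)
    Y zero    = constPS 1ℤ
    Y (suc r) = B (2 + r * 3)
    p q p′ q′ : ℕ → ℤ
    -- The pattern (3r + 1)(3r) would give 0 at r = 0; the boundary term of `Γ-zero` contributes 1
    -- instead.
    p zero    = 1ℤ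
    p (suc r) = + (4 + r * 3) *ᶻ + (3 + r * 3)
    q r       = + (1 + r * 3) *ᶻ + (2 + r * 3)
    p′ r      = + (2 + r * 3)
    q′ r      = + (3 + r * 3)
    X-rec : ∀ r → X r ≈ λ i → p r *ᶻ xpow 2 (Y r) i -ᶻ q r *ᶻ xpow 2 (Y (suc r)) i
    X-rec zero    = A-suc 0 1ℤ (+ 2) Γ-zero
    X-rec (suc r) = A-suc (3 + r * 3) (+ (3 + r * 3)) (+ (5 + r * 3)) (Γ-suc (2 + r * 3))
    Y-rec : ∀ r → Y (suc r) ≈ λ i → p′ r *ᶻ xpow 1 (X r) i -ᶻ q′ r *ᶻ xpow 1 (X (suc r)) i
    Y-rec r = B-suc (1 + r * 3)
    a-odd : ∀ r → q r *ᶻ p′ r ≡ a (suc (r * 2))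
    a-odd r = begin
      + (1 + m) *ᶻ + (2 + m) *ᶻ + (2 + m)         ≡⟨ pos-*-square (1 + m) (2 + m) ⟩
      -- For t = 3 + m the truncated differences t ∸ 2 and t ∸ 1 compute to 1 + m and 2 + m.
      + ((1 + m) * ((2 + m) * (2 + m)))           ≡⟨ via-*-comm (λ t → (t ∸ 2) * ((t ∸ 1) * (t ∸ 1))) r ⟩
      + o (suc r)                                 ≡⟨ alt-odd o e r ⟨
      a (suc (r * 2))                             ∎
      where
      open ≡-Reasoning
      m = r * 3
    a-even : ∀ r → q′ r *ᶻ p (suc r) ≡ a (suc (suc (r * 2)))
    a-even r = begin
      + t *ᶻ (+ (1 + t) *ᶻ + t)      ≡⟨ pos-square-* t (1 + t) ⟩
      + (t * t * (1 + t))            ≡⟨ cong (λ u → + (t * t * u)) (ℕ.+-comm 1 t) ⟩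
      + (t * t * (t + 1))            ≡⟨ via-*-comm (λ t → t * t * (t + 1)) r ⟩
      + e (suc r)                    ≡⟨ alt-even o e r ⟨
      a (suc (suc (r * 2)))          ∎
      where
      open ≡-Reasoning
      t = 3 + r * 3

  cm-fraction : CFEquals (laplace cm) 1
    (alt (λ r → ((3 * r ∸ 2) * (3 * r ∸ 2)) * (3 * r ∸ 1)) (λ r → (3 * r ∸ 1) * ((3 * r) * (3 * r))))
  cm-fraction = CFEquals-resp 1 a (laplace-cong (egfMul-identityˡ cm))
    (TwoSequences.continued-fraction 0 1 p q p′ q′ X Y a refl X-rec Y-rec a-odd a-even
      0 refl (λ _ → refl))
    where
    o e : ℕ → ℕ
    o r = ((3 * r ∸ 2) * (3 * r ∸ 2)) * (3 * r ∸ 1)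
    e r = (3 * r ∸ 1) * ((3 * r) * (3 * r))
    a = alt o e
    X Y : ℕ → PS
    X r       = B (r * 3)
    Y zero    = constPS 1ℤ
    Y (suc r) = A (2 + r * 3)
    p q p′ q′ : ℕ → ℤ
    p zero    = 1ℤ
    p (suc r) = + (3 + r * 3)
    q r       = + (1 + r * 3)
    p′ r      = + (2 + r * 3) *ᶻ + (1 + r * 3)
    q′ r      = + (2 + r * 3) *ᶻ + (3 + r * 3)
    X-rec : ∀ r → X r ≈ λ i → p r *ᶻ xpow 1 (Y r) i -ᶻ q r *ᶻ xpow 1 (Y (suc r)) i
    X-rec zero    = B-zero
    X-rec (suc r) = B-suc (2 + r * 3)
    Y-rec : ∀ r → Y (suc r) ≈ λ i → p′ r *ᶻ xpow 2 (X r) i -ᶻ q′ r *ᶻ xpow 2 (X (suc r)) i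
    Y-rec r = A-suc (1 + r * 3) (+ (1 + r * 3)) (+ (3 + r * 3)) (Γ-suc (r * 3))
    a-odd : ∀ r → q r *ᶻ p′ r ≡ a (suc (r * 2))
    a-odd r = begin
      + t *ᶻ (+ (1 + t) *ᶻ + t)      ≡⟨ pos-square-* t (1 + t) ⟩
      + (t * t * (1 + t))            ≡⟨ via-*-comm (λ u → (u ∸ 2) * (u ∸ 2) * (u ∸ 1)) r ⟩
      + o (suc r)                    ≡⟨ alt-odd o e r ⟨
      a (suc (r * 2))                ∎
      where
      open ≡-Reasoning
      t = 1 + r * 3
    a-even : ∀ r → q′ r *ᶻ p (suc r) ≡ a (suc (suc (r * 2)))
    a-even r = begin
      + (2 + m) *ᶻ + (3 + m) *ᶻ + (3 + m)     ≡⟨ pos-*-square (2 + m) (3 + m) ⟩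
      + ((2 + m) * ((3 + m) * (3 + m)))       ≡⟨ via-*-comm (λ t → (t ∸ 1) * (t * t)) r ⟩
      + e (suc r)                             ≡⟨ alt-even o e r ⟨
      a (suc (suc (r * 2)))                   ∎
      where
      open ≡-Reasoning
      m = r * 3

  smcm-fraction : CFEquals (laplace (egfMul sm cm)) 2
    (alt (λ r → ((3 * r ∸ 1) * (3 * r ∸ 1)) * (3 * r)) (λ r → (3 * r) * ((3 * r + 1) * (3 * r + 1))))
  smcm-fraction = CFEquals-resp 2 a (laplace-cong (egfMul-cong {g = cm} (egfMul-identityʳ sm) (λ _ → refl)))
    -- This chain starts at `A 0`, the transform of 1, which is x; with the factor x of `X-rec` it
    -- makes up the numerator x².
    (TwoSequences.continued-fraction 0 1 p q p′ q′ X Y a refl X-rec Y-rec a-odd a-even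
      1 refl laplace-one)
    where
    o e : ℕ → ℕ
    o r = ((3 * r ∸ 1) * (3 * r ∸ 1)) * (3 * r)
    e r = (3 * r) * ((3 * r + 1) * (3 * r + 1))
    a = alt o e
    X Y : ℕ → PS
    X r = B (1 + r * 3)
    Y r = A (r * 3)
    p q p′ q′ : ℕ → ℤ
    p r  = + (1 + r * 3)
    q r  = + (2 + r * 3)
    p′ r = + (3 + r * 3) *ᶻ + (2 + r * 3)
    q′ r = + (3 + r * 3) *ᶻ + (4 + r * 3)
    X-rec : ∀ r → X r ≈ λ i → p r *ᶻ xpow 1 (Y r) i -ᶻ q r *ᶻ xpow 1 (Y (suc r)) i
    X-rec r = B-suc (r * 3)
    Y-rec : ∀ r → Y (suc r) ≈ λ i → p′ r *ᶻ xpow 2 (X r) i -ᶻ q′ r *ᶻ xpow 2 (X (suc r)) i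
    Y-rec r = A-suc (2 + r * 3) (+ (2 + r * 3)) (+ (4 + r * 3)) (Γ-suc (1 + r * 3))
    a-odd : ∀ r → q r *ᶻ p′ r ≡ a (suc (r * 2))
    a-odd r = begin
      + t *ᶻ (+ (1 + t) *ᶻ + t)      ≡⟨ pos-square-* t (1 + t) ⟩
      + (t * t * (1 + t))            ≡⟨ via-*-comm (λ u → (u ∸ 1) * (u ∸ 1) * u) r ⟩
      + o (suc r)                    ≡⟨ alt-odd o e r ⟨
      a (suc (r * 2))                ∎
      where
      open ≡-Reasoning
      t = 2 + r * 3
    a-even : ∀ r → q′ r *ᶻ p (suc r) ≡ a (suc (suc (r * 2)))
    a-even r = begin
      + t *ᶻ + (1 + t) *ᶻ + (1 + t)  ≡⟨ pos-*-square t (1 + t) ⟩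
      + (t * ((1 + t) * (1 + t)))    ≡⟨ cong (λ u → + (t * (u * u))) (ℕ.+-comm 1 t) ⟩
      + (t * ((t + 1) * (t + 1)))    ≡⟨ via-*-comm (λ t → t * ((t + 1) * (t + 1))) r ⟩
      + e (suc r)                    ≡⟨ alt-even o e r ⟨
      a (suc (suc (r * 2)))          ∎
      where
      open ≡-Reasoning
      t = 3 + r * 3

mainTheorem2 : (sm cm : ℕ → ℤ) → IsDixonPair sm cm →
    CFEquals (laplace sm) 2
    (alt (λ r → (3 * r ∸ 2) * ((3 * r ∸ 1) * (3 * r ∸ 1)))
    (λ r → ((3 * r) * (3 * r)) * (3 * r + 1)))
    × CFEquals (laplace cm) 1
    (alt (λ r → ((3 * r ∸ 2) * (3 * r ∸ 2)) * (3 * r ∸ 1))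
    (λ r → (3 * r ∸ 1) * ((3 * r) * (3 * r))))
    × CFEquals (laplace (egfMul sm cm)) 2
    (alt (λ r → ((3 * r ∸ 1) * (3 * r ∸ 1)) * (3 * r))
    (λ r → (3 * r) * ((3 * r + 1) * (3 * r + 1))))
mainTheorem2 sm cm (sm₀ , cm₀ , sm′ , cm′) = sm-fraction , cm-fraction , smcm-fraction
  where open Fractions sm cm sm₀ cm₀ sm′ cm′
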